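{- Let $H$, $F$ be fixed graphs and $s$ a fixed positive integer, and suppose $H$ contains neither $F$ nor $M_{s+1}$ as a subgraph. Then $\mathrm{ex}(n,H,\{F,M_{s+1}\})=\Theta(n^{b'(H,F,s)})$ as $n\to\infty$.
   Context: All graphs are finite and simple. $M_{s+1}$ is the graph of $s+1$ pairwise disjoint edges. For a family $\mathcal F$ of graphs, $\mathrm{ex}(n,H,\mathcal F)$ is the maximum number of copies of $H$ (subgraphs isomorphic to $H$) in an $n$-vertex graph containing no member of $\mathcal F$ as a subgraph. Given a graph $H$, a set $U\subseteq V(H)$ and a positive integer $m$, the partial $(m,U)$-blowup of $H$ is obtained by replacing each vertex $u\in U$ by $m$ vertices $u_1,\dots,u_m$ and each vertex $u\notin U$ by a single vertex $u_1$, and replacing each edge $uv$ of $H$ by all edges $u_iv_j$ (over all available indices $i,j$). $b'(H,F,s)$ denotes the largest order of a set $U\subseteq V(H)$ such that for every $m$, neither $F$ nor $M_{s+1}$ is a subgraph of the partial $(m,U)$-blowup of $H$. The constants in $\Theta$ depend on $H,F,s$.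
   Formalization: Added hypothesis: if F is contained in H plus some isolated vertices, then F is already contained in H. Without it the claim fails, e.g. H = K2, F = K2 plus an isolated vertex, where ex(n,H,{F,M_{s+1}}) = 0 for n ≥ 3 but b' = 0. -}

module Defs where

open import Data.Bool.Base using (true; false; if_then_else_)
open import Data.Empty using (⊥)
open import Data.Fin.Base using (Fin; quotient; finToFun; funToFin)
open import Data.Fin.Properties using (_≟_; any?; all?; finToFun-funToFin)
open import Data.Fin.Subset using (Subset; _∈_; ∣_∣)
open import Data.Fin.Subset.Properties using (_∈?_)
open import Data.List.Base
  using (List; []; _∷_; length; map; filter; cartesianProduct; cartesianProductWith)
open import Data.List.Extrema.Nat using (max)
open import Data.List.Relation.Unary.All as All using (All)
open import Data.Nat.Base using (ℕ; zero; suc; _*_; _≤_; NonZero)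
open import Data.Product.Base using (∃; Σ; _×_; _,_)
open import Data.Sum.Base using (_⊎_; inj₁; inj₂; swap)
open import Data.Vec.Base as Vec using (Vec; []; _∷_; lookup)
open import Function.Base using (_∘_)
open import Function.Bundles using (_⇔_; mk⇔; Equivalence)
open import Function.Definitions using (Injective)
open import Level using (0ℓ)
open import Relation.Binary.Core using (Rel)
open import Relation.Binary.Definitions
  using (Decidable; Symmetric; Irreflexive)
open import Relation.Binary.PropositionalEquality
  using (_≡_; _≢_; _≗_; refl; sym; trans; subst; subst₂)
open import Relation.Nullary.Decidable
  using (Dec; no; does; map′; ¬?; _×-dec_; _⊎-dec_; _→-dec_)
open import Relation.Nullary.Negation using (¬_)

------------------------------------------------------------------------
-- Simple graphs

record Graph (V : Set) : Set₁ where
  field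
    Adj    : Rel V 0ℓ
    adj?   : Decidable Adj
    symm   : Symmetric Adj
    irrefl : Irreflexive _≡_ Adj

open Graph public

FiniteGraph : Set₁
FiniteGraph = ∃ λ n → Graph (Fin n)

private
  variable
    V W : Set
    f h n : ℕ

-- F ⊑ G: some subgraph of G, not necessarily induced, is isomorphic to F.

IsEmbedding : Graph V → Graph W → (V → W) → Set
IsEmbedding F G φ =
  Injective _≡_ _≡_ φ × (∀ u v → Adj F u v → Adj G (φ u) (φ v))

infix 4 _⊑_

_⊑_ : Graph V → Graph W → Set
F ⊑ G = ∃ (IsEmbedding F G)

-- The edges of M k are the k fibres of Fin (k * 2) → Fin k.

M : ∀ k → Graph (Fin (k * 2))
M k = record
  { Adj    = λ u v → quotient {k} 2 u ≡ quotient {k} 2 v × u ≢ v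
  ; adj?   = λ u v → (quotient {k} 2 u ≟ quotient {k} 2 v) ×-dec ¬? (u ≟ v)
  ; symm   = λ (p , q) → sym p , q ∘ sym
  ; irrefl = λ eq (_ , q) → q eq
  }

-- Isolated vertices of F matter to containment in small graphs.  With F an
-- edge plus an isolated vertex and H a single edge, H is F-free and its blowup
-- number is at least 0 (take U = ∅), yet no F-free graph on n ≥ 3 vertices has
-- an edge, so ex(n,H,{F,M_{s+1}}) = 0.  Hypotheses phrased with addIsolated
-- exclude exactly such F; they hold whenever F has no isolated vertex or has at
-- most as many vertices as H.

addIsolated : ∀ k → Graph V → Graph (V ⊎ Fin k)
addIsolated {V} k G = record
  { Adj    = A
  ; adj?   = A?
  ; symm   = λ {x} {y} → A-symm x y
  ; irrefl = λ {x} {y} → A-irrefl x y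
  }
  where
  A : Rel (V ⊎ Fin k) 0ℓ
  A (inj₁ u) (inj₁ v) = Adj G u v
  A (inj₁ _) (inj₂ _) = ⊥
  A (inj₂ _) _        = ⊥

  A? : Decidable A
  A? (inj₁ u) (inj₁ v) = adj? G u v
  A? (inj₁ _) (inj₂ _) = no λ ()
  A? (inj₂ _) _        = no λ ()

  A-symm : ∀ x y → A x y → A y x
  A-symm (inj₁ u) (inj₁ v) = symm G

  A-irrefl : ∀ x y → x ≡ y → ¬ A x y
  A-irrefl (inj₁ u) (inj₁ .u) refl = irrefl G refl

------------------------------------------------------------------------
-- Partial blowups

multiplicity : ℕ → Subset h → Fin h → ℕ
multiplicity m U u = if does (u ∈? U) then m else 1

BlowupVertex : ℕ → Subset h → Set
BlowupVertex {h} m U = Σ (Fin h) λ u → Fin (multiplicity m U u)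

blowup : (m : ℕ) (U : Subset h) → Graph (Fin h) → Graph (BlowupVertex m U)
blowup m U H = record
  { Adj    = λ (u , _) (v , _) → Adj H u v
  ; adj?   = λ (u , _) (v , _) → adj? H u v
  ; symm   = symm H
  ; irrefl = λ { refl → irrefl H refl }
  }

Admissible : Graph (Fin h) → Graph (Fin f) → ℕ → Subset h → Set
Admissible H F s U =
  ∀ m → .{{NonZero m}} → ¬ F ⊑ blowup m U H × ¬ M (suc s) ⊑ blowup m U H

-- IsBlowupNumber H F s b: b is the largest order b'(H,F,s) of an
-- admissible set.

IsBlowupNumber : Graph (Fin h) → Graph (Fin f) → ℕ → ℕ → Set
IsBlowupNumber H F s b =
  (∃ λ U → Admissible H F s U × ∣ U ∣ ≡ b) ×
  (∀ U → Admissible H F s U → ∣ U ∣ ≤ b)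

------------------------------------------------------------------------
-- Counting copies

anyFunction? : {P : (Fin h → Fin n) → Set} →
               (∀ {φ ψ} → φ ≗ ψ → P φ → P ψ) →
               (∀ φ → Dec (P φ)) → Dec (∃ P)
anyFunction? resp P? = map′
  (λ (i , p) → finToFun i , p)
  (λ (φ , p) → funToFin φ , resp (sym ∘ finToFun-funToFin φ) p)
  (any? (P? ∘ finToFun))

infix 3 _⇔?_

_⇔?_ : {A B : Set} → Dec A → Dec B → Dec (A ⇔ B)
a? ⇔? b? = map′ (λ (p , q) → mk⇔ p q)
                (λ e → Equivalence.to e , Equivalence.from e)
                ((a? →-dec b?) ×-dec (b? →-dec a?))

injective? : (φ : Fin h → Fin n) → Dec (Injective _≡_ _≡_ φ)
injective? φ = map′
  (λ inj {u} {v} → inj u v) (λ inj u v → inj {u} {v})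
  (all? λ u → all? λ v → (φ u ≟ φ v) →-dec (u ≟ v))

injective-resp : {φ ψ : Fin h → Fin n} → φ ≗ ψ →
                 Injective _≡_ _≡_ φ → Injective _≡_ _≡_ ψ
injective-resp eq inj {u} {v} p = inj (trans (eq u) (trans p (sym (eq v))))

⊑? : (F : Graph (Fin f)) (G : Graph (Fin n)) → Dec (F ⊑ G)
⊑? F G = anyFunction?
  (λ eq (inj , hom) → injective-resp eq inj ,
     λ u v a → subst₂ (Adj G) (eq u) (eq v) (hom u v a))
  (λ φ → injective? φ ×-dec
     all? λ u → all? λ v → adj? F u v →-dec adj? G (φ u) (φ v))

-- A vertex set together with an edge set given by its adjacency matrix:
-- row u is the set of neighbours of u.

AdjacencyMatrix : ℕ → Set
AdjacencyMatrix n = Vec (Subset n) n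

Candidate : ℕ → Set
Candidate n = Subset n × AdjacencyMatrix n

IsSubgraph : Graph (Fin n) → Candidate n → Set
IsSubgraph G (S , E) =
  ∀ u v → v ∈ lookup E u → Adj G u v × u ∈ S × u ∈ lookup E v

IsIsomorphism : Graph (Fin h) → Candidate n → (Fin h → Fin n) → Set
IsIsomorphism H (S , E) φ =
  Injective _≡_ _≡_ φ ×
  (∀ x → x ∈ S ⇔ ∃ λ u → φ u ≡ x) ×
  (∀ u v → Adj H u v ⇔ φ v ∈ lookup E (φ u))

IsCopy : Graph (Fin h) → Graph (Fin n) → Candidate n → Set
IsCopy H G C = IsSubgraph G C × ∃ (IsIsomorphism H C)

isCopy? : (H : Graph (Fin h)) (G : Graph (Fin n)) (C : Candidate n) →
          Dec (IsCopy H G C)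
isCopy? H G (S , E) =
  (all? λ u → all? λ v → (v ∈? lookup E u) →-dec
     (adj? G u v ×-dec (u ∈? S) ×-dec (u ∈? lookup E v)))
  ×-dec
  anyFunction?
    (λ eq (inj , onto , iso) →
       injective-resp eq inj ,
       (λ x → mk⇔
         (λ x∈S → let (u , p) = Equivalence.to (onto x) x∈S
                  in u , trans (sym (eq u)) p)
         (λ (u , p) → Equivalence.from (onto x) (u , trans (eq u) p))) ,
       (λ u v → subst₂ (λ x y → Adj H u v ⇔ y ∈ lookup E x)
                  (eq u) (eq v) (iso u v)))
    (λ φ → injective? φ
       ×-dec (all? λ x → (x ∈? S) ⇔? any? λ u → φ u ≟ x)
       ×-dec (all? λ u → all? λ v → adj? H u v ⇔? φ v ∈? lookup E (φ u)))

-- Each vector over a repetition-free list is listed exactly once.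

vectors : {A : Set} → List A → ∀ n → List (Vec A n)
vectors xs zero    = [] ∷ []
vectors xs (suc n) = cartesianProductWith _∷_ xs (vectors xs n)

subsets : ∀ n → List (Subset n)
subsets = vectors (true ∷ false ∷ [])

matrices : ∀ n → List (AdjacencyMatrix n)
matrices n = vectors (subsets n) n

copies : Graph (Fin h) → Graph (Fin n) → ℕ
copies {n = n} H G =
  length (filter (isCopy? H G) (cartesianProduct (subsets n) (matrices n)))

------------------------------------------------------------------------
-- The extremal function

-- Symmetrising and dropping the diagonal makes every matrix a simple graph,
-- and turns the matrix of a simple graph into that graph; the resulting
-- repetitions in `graphs` do not affect a maximum.

fromMatrix : AdjacencyMatrix n → Graph (Fin n)
fromMatrix E = record
  { Adj    = λ u v → u ≢ v × (v ∈ lookup E u ⊎ u ∈ lookup E v)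
  ; adj?   = λ u v → ¬? (u ≟ v) ×-dec ((v ∈? lookup E u) ⊎-dec (u ∈? lookup E v))
  ; symm   = λ (p , q) → p ∘ sym , swap q
  ; irrefl = λ eq (p , _) → p eq
  }

graphs : ∀ n → List (Graph (Fin n))
graphs n = map fromMatrix (matrices n)

Free : List FiniteGraph → Graph (Fin n) → Set₁
Free 𝓕 G = All (λ (_ , F) → ¬ F ⊑ G) 𝓕

free? : (𝓕 : List FiniteGraph) (G : Graph (Fin n)) → Dec (Free 𝓕 G)
free? 𝓕 G = All.all? (λ (_ , F) → ¬? (⊑? F G)) 𝓕

-- The value is 0 if no graph on n vertices is 𝓕-free.

ex : ℕ → Graph (Fin h) → List FiniteGraph → ℕ
ex n H 𝓕 = max 0 (map (copies H) (filter (free? 𝓕) (graphs n)))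

------------------------------------------------------------------------
-- Asymptotics

infix 4 _=O_ _=Θ_

_=O_ : (ℕ → ℕ) → (ℕ → ℕ) → Set
g₁ =O g₂ = ∃ λ C → ∃ λ N → ∀ n → N ≤ n → g₁ n ≤ C * g₂ n

_=Θ_ : (ℕ → ℕ) → (ℕ → ℕ) → Set
g₁ =Θ g₂ = g₁ =O g₂ × g₂ =O g₁

{-# OPTIONS --safe #-}

-- F embeds in some (m,U)-blowup of H iff F maps homomorphically to H with all
-- fibres over vertices outside U of size at most 1 (a "folding").  In
-- particular admissibility of U is decidable, so b' exists.
--
-- Upper bound.  A graph G without M_{s+1} has a vertex cover of bounded size,
-- so all but boundedly many vertices of G are large, i.e. have at least
-- K = f + 2(s+1) twins.  Given a copy φ of H in G, the set U of vertices
-- that φ sends to large vertices is admissible: a folding of F or M_{s+1}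
-- over U unfolds to an embedding in G, distinct twins being available.  Hence
-- at most b' coordinates of φ range over more than boundedly many vertices.
--
-- Lower bound.  The (m,U)-blowup with m about n/h, padded with isolated
-- vertices, contains m^|U| copies of H.  If U is nonempty, the isolated
-- vertices can be folded onto a vertex of U; if U is empty, the hypothesis on
-- F takes care of them.

module Submission where

open import Defs
open import Data.Bool.Base using (Bool; true; false)
import Data.Bool.Properties as Bool
open import Data.Fin.Base using (Fin; zero; suc; toℕ; combine; inject≤)
open import Data.Fin.Properties
  using (_≟_; any?; all?; injective⇒≤; combine-injective; inject≤-injective;
         suc-injective; toℕ-injective)
open import Data.Fin.Subset using (Subset; _∈_; _∉_; _⊆_; ∣_∣; ⊥)
open import Data.Fin.Subset.Properties using (_∈?_; ⊆-antisym; nonempty?; ∉⊥)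
open import Data.List.Base as List
  using (List; []; _∷_; _++_; length; filter; take; allFin; concatMap;
         cartesianProduct; cartesianProductWith)
open import Data.List.Extrema.Nat
  using (argmax; argmax-all; f[xs]≤f[argmax]; max≤v⁺; xs≤max)
open import Data.List.Membership.Propositional using (lose) renaming (_∈_ to _∈ˡ_)
open import Data.List.Membership.Propositional.Properties
open import Data.List.Properties
  using (length-++; length-map; length-take; take-all; length-tabulate)
open import Data.List.Relation.Unary.All as All using ([]; _∷_)
import Data.List.Relation.Unary.All.Properties as All
open import Data.List.Relation.Unary.AllPairs using ([]; _∷_)
open import Data.List.Relation.Unary.Any as Any using (here; there)
import Data.List.Relation.Unary.Any.Properties as Any
open import Data.List.Relation.Unary.Unique.Propositional using (Unique)
import Data.List.Relation.Unary.Unique.Propositional.Properties as Unique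
open import Data.Nat.Base
  using (ℕ; zero; suc; _+_; _*_; _^_; _≤_; z≤n; s≤s; >-nonZero; _/_; _%_)
open import Data.Nat.DivMod using (m≡m%n+[m/n]*n; m%n<n; m/n*n≤m; m/n≡0⇒m<n)
open import Data.Nat.Properties as ℕ hiding (_≟_; suc-injective)
open import Data.Nat.Tactic.RingSolver using (solve-∀)
open import Data.Product.Base using (∃; ∃₂; _×_; _,_; proj₁; proj₂)
open import Data.Sum.Base as Sum using (_⊎_; inj₁; inj₂; [_,_]′)
open import Data.Sum.Properties using (inj₁-injective; inj₂-injective)
open import Data.Vec.Base as Vec using (Vec; []; _∷_; lookup; tabulate; _[_]≔_; here; there)
open import Data.Vec.Properties
open import Function.Base using (_∘_; id; case_of_)
open import Function.Bundles using (_⇔_; mk⇔; Equivalence)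
open import Function.Definitions using (Injective)
open import Level using (0ℓ)
open import Relation.Binary.PropositionalEquality
open import Relation.Nullary.Decidable
open import Relation.Nullary.Negation using (¬_; contradiction)
open import Relation.Unary using (Pred; Decidable)

private
  variable
    A B C V : Set
    h f n m : ℕ

-- Subsets and adjacency matrices from decidable predicates

⟦_⟧ : {P : Pred (Fin n) 0ℓ} → Decidable P → Subset n
⟦ P? ⟧ = tabulate (does ∘ P?)

∈⟦⟧ : {P : Pred (Fin n) 0ℓ} (P? : Decidable P) {x : Fin n} → x ∈ ⟦ P? ⟧ ⇔ P x
∈⟦⟧ {P = P} P? {x} = mk⇔ to from
  where
  to : x ∈ ⟦ P? ⟧ → P x
  to x∈ with P? x | trans (sym (lookup∘tabulate (does ∘ P?) x)) ([]=⇒lookup x∈)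
  ... | yes p | _ = p

  from : P x → x ∈ ⟦ P? ⟧
  from p = lookup⇒[]= x _ (trans (lookup∘tabulate (does ∘ P?) x) (dec-true (P? x) p))

matrix : {R : Fin n → Fin n → Set} → (∀ x y → Dec (R x y)) → AdjacencyMatrix n
matrix R? = tabulate λ x → ⟦ R? x ⟧

∈-matrix : {R : Fin n → Fin n → Set} (R? : ∀ x y → Dec (R x y)) → ∀ {x y} →
  y ∈ lookup (matrix R?) x ⇔ R x y
∈-matrix R? {x} {y} = mk⇔
  (Equivalence.to (∈⟦⟧ (R? x)) ∘ subst (y ∈_) (lookup∘tabulate _ x))
  (subst (y ∈_) (sym (lookup∘tabulate _ x)) ∘ Equivalence.from (∈⟦⟧ (R? x)))

lookup-ext : {v w : Vec A n} → lookup v ≗ lookup w → v ≡ w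
lookup-ext {v = v} {w} eq =
  trans (sym (tabulate∘lookup v)) (trans (tabulate-cong eq) (tabulate∘lookup w))

-- Lengths of lists

lookup-injective : {xs : List A} → Unique xs → Injective _≡_ _≡_ (List.lookup xs)
lookup-injective (_ ∷ _)  {zero}  {zero}  _  = refl
lookup-injective (x ∷ _)  {zero}  {suc j} eq =
  contradiction eq (All.lookup x (∈-lookup j))
lookup-injective (x ∷ _)  {suc i} {zero}  eq =
  contradiction (sym eq) (All.lookup x (∈-lookup i))
lookup-injective (_ ∷ xs) {suc i} {suc j} eq = cong suc (lookup-injective xs eq)

-- Taking the position in `ys` of a partner of each entry of `xs` gives an injection between index
-- sets. A relation replaces a function because the partner of a copy comes out of an existential
-- proof.
length-injective-relation : (R : A → B → Set) →
  (∀ {x x′ y} → R x y → R x′ y → x ≡ x′) →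
  {xs : List A} {ys : List B} → Unique xs →
  (∀ {x} → x ∈ˡ xs → ∃ λ y → y ∈ˡ ys × R x y) → length xs ≤ length ys
length-injective-relation R R-inj {xs} {ys} unique total =
  injective⇒≤ {f = λ i → Any.index (y∈ i)} λ {i} {j} eq →
    lookup-injective unique (R-inj (r i) (subst (R _) (same eq) (r j)))
  where
  y  = λ i → proj₁ (total (∈-lookup {xs = xs} i))
  y∈ = λ i → proj₁ (proj₂ (total (∈-lookup {xs = xs} i)))
  r  = λ i → proj₂ (proj₂ (total (∈-lookup {xs = xs} i)))

  same : ∀ {i j} → Any.index (y∈ i) ≡ Any.index (y∈ j) → y j ≡ y i
  same {i} {j} eq = trans (Any.lookup-index (y∈ j))
    (trans (cong (List.lookup ys) (sym eq)) (sym (Any.lookup-index (y∈ i))))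

length-⊆ : {xs ys : List A} → Unique xs → (∀ {x} → x ∈ˡ xs → x ∈ˡ ys) → length xs ≤ length ys
length-⊆ unique xs⊆ys = length-injective-relation _≡_ (λ p q → trans p (sym q)) unique
  (λ x∈ → _ , xs⊆ys x∈ , refl)

length-cartesianProductWith : (g : A → B → C) (xs : List A) (ys : List B) →
  length (cartesianProductWith g xs ys) ≡ length xs * length ys
length-cartesianProductWith g []       ys = refl
length-cartesianProductWith g (x ∷ xs) ys = trans (length-++ (List.map (g x) ys))
  (cong₂ _+_ (length-map (g x) ys) (length-cartesianProductWith g xs ys))

length-concatMap-≤ : (g : A → List B) {k : ℕ} → (∀ x → length (g x) ≤ k) →
  ∀ xs → length (concatMap g xs) ≤ length xs * k
length-concatMap-≤ g g≤k []       = z≤n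
length-concatMap-≤ g {k} g≤k (x ∷ xs) = begin
  length (g x ++ concatMap g xs)         ≡⟨ length-++ (g x) ⟩
  length (g x) + length (concatMap g xs) ≤⟨ +-mono-≤ (g≤k x) (length-concatMap-≤ g g≤k xs) ⟩
  k + length xs * k                      ∎
  where open ≤-Reasoning

-- Enumeration of vectors, subsets and candidates

∈-vectors : {xs : List A} → (∀ x → x ∈ˡ xs) → (v : Vec A n) → v ∈ˡ vectors xs n
∈-vectors x∈ []      = here refl
∈-vectors x∈ (x ∷ v) = ∈-cartesianProductWith⁺ _∷_ (x∈ x) (∈-vectors x∈ v)

vectors-unique : {xs : List A} → Unique xs → ∀ n → Unique (vectors xs n)
vectors-unique xs! zero    = [] ∷ []
vectors-unique xs! (suc n) =
  Unique.cartesianProductWith⁺ _∷_ ∷-injective xs! (vectors-unique xs! n)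

private
  bools : List Bool
  bools = true ∷ false ∷ []

∈-bools : ∀ b → b ∈ˡ bools
∈-bools true  = here refl
∈-bools false = there (here refl)

∈-subsets : (S : Subset n) → S ∈ˡ subsets n
∈-subsets = ∈-vectors ∈-bools

∈-matrices : (E : AdjacencyMatrix n) → E ∈ˡ matrices n
∈-matrices = ∈-vectors ∈-subsets

candidates-unique : ∀ n → Unique (cartesianProduct (subsets n) (matrices n))
candidates-unique n = Unique.cartesianProduct⁺ subsets! (vectors-unique subsets! n)
  where
  subsets! : Unique (subsets n)
  subsets! = vectors-unique (((λ ()) ∷ []) ∷ [] ∷ []) n

-- Foldings

IsFolding : Graph V → Graph (Fin h) → Subset h → (V → Fin h) → Set
IsFolding F H U χ =
  (∀ u v → Adj F u v → Adj H (χ u) (χ v)) ×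
  (∀ u v → χ u ≡ χ v → u ≡ v ⊎ χ u ∈ U)

Folds : Graph V → Graph (Fin h) → Subset h → Set
Folds F H U = ∃ (IsFolding F H U)

folds? : (F : Graph (Fin f)) (H : Graph (Fin h)) (U : Subset h) → Dec (Folds F H U)
folds? F H U = anyFunction?
  (λ eq (hom , fib) →
    (λ u v a → subst₂ (Adj H) (eq u) (eq v) (hom u v a)) ,
    (λ u v p → Sum.map₂ (subst (_∈ U) (eq u))
      (fib u v (trans (eq u) (trans p (sym (eq v)))))))
  (λ χ →
    (all? λ u → all? λ v → adj? F u v →-dec adj? H (χ u) (χ v)) ×-dec
    (all? λ u → all? λ v → (χ u ≟ χ v) →-dec ((u ≟ v) ⊎-dec (χ u ∈? U))))

clones-irrelevant : (U : Subset h) {u : Fin h} → u ∉ U →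
  (i j : Fin (multiplicity m U u)) → i ≡ j
clones-irrelevant U {u} u∉U with u ∈? U
... | yes u∈U = contradiction u∈U u∉U
... | no  _   = λ { zero zero → refl }

blowup-fibre : {U : Subset h} (p q : BlowupVertex m U) →
  proj₁ p ≡ proj₁ q → p ≡ q ⊎ proj₁ p ∈ U
blowup-fibre {U = U} (u , i) (.u , j) refl with toSum (u ∈? U)
... | inj₁ u∈U = inj₂ u∈U
... | inj₂ u∉U = inj₁ (cong (u ,_) (clones-irrelevant U u∉U i j))

⊑blowup⇒folds : (F : Graph V) (H : Graph (Fin h)) (U : Subset h) →
  F ⊑ blowup m U H → Folds F H U
⊑blowup⇒folds F H U (ψ , inj , hom) = proj₁ ∘ ψ , hom ,
  λ u v eq → Sum.map₁ inj (blowup-fibre (ψ u) (ψ v) eq)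

-- A vertex `v` folded onto `U` takes the clone `suc v`, so distinct vertices never collide there.
-- Having `suc f` clones keeps the multiplicity nonzero even when `f` is 0, as `Admissible`
-- requires.
folds⇒⊑blowup : (F : Graph (Fin f)) (H : Graph (Fin h)) (U : Subset h) →
  Folds F H U → F ⊑ blowup (suc f) U H
folds⇒⊑blowup {f = f} {h = h} F H U (χ , hom , fib) = ψ , ψ-inj , hom
  where
  clone : Fin f → (u : Fin h) → Fin (multiplicity (suc f) U u)
  clone v u with u ∈? U
  ... | yes _ = suc v
  ... | no  _ = zero

  toℕ-clone : ∀ v {u} → u ∈ U → toℕ (clone v u) ≡ suc (toℕ v)
  toℕ-clone v {u} u∈U with u ∈? U
  ... | yes _   = refl
  ... | no  u∉U = contradiction u∈U u∉U

  ψ : Fin f → BlowupVertex (suc f) U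
  ψ v = χ v , clone v (χ v)

  ψ-inj : Injective _≡_ _≡_ ψ
  ψ-inj {v} {v′} eq with fib v v′ (cong proj₁ eq)
  ... | inj₁ v≡v′ = v≡v′
  ... | inj₂ u∈U  = toℕ-injective (ℕ.suc-injective (begin
    suc (toℕ v)              ≡⟨ toℕ-clone v u∈U ⟨
    toℕ (proj₂ (ψ v))        ≡⟨ cong (toℕ ∘ proj₂) eq ⟩
    toℕ (proj₂ (ψ v′))       ≡⟨ toℕ-clone v′ (subst (_∈ U) (cong proj₁ eq) u∈U) ⟩
    suc (toℕ v′)             ∎))
    where open ≡-Reasoning

-- With no vertex allowed a large fibre, a folding is injective. This is what makes the empty set
-- admissible.
folds-⊥⇒⊑ : (F : Graph V) (H : Graph (Fin h)) → Folds F H ⊥ → F ⊑ H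
folds-⊥⇒⊑ F H (χ , hom , fib) = χ , inj , hom
  where
  inj : Injective _≡_ _≡_ χ
  inj {u} {v} eq = [ id , (λ χu∈⊥ → contradiction χu∈⊥ ∉⊥) ]′ (fib u v eq)

-- A folding does not mention `m`: it arises from an embedding into any blowup, and it yields one
-- for a single large `m`. The quantifier over all `m` thus becomes a decidable condition.
admissible⇔ : (H : Graph (Fin h)) (F : Graph (Fin f)) (s : ℕ) (U : Subset h) →
  (¬ Folds F H U × ¬ Folds (M (suc s)) H U) ⇔ Admissible H F s U
admissible⇔ {h = h} H F s U = mk⇔ to from
  where
  to : ¬ Folds F H U × ¬ Folds (M (suc s)) H U → Admissible H F s U
  to (¬F , ¬M) m = ¬F ∘ ⊑blowup⇒folds F H U , ¬M ∘ ⊑blowup⇒folds (M (suc s)) H U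

  from : Admissible H F s U → ¬ Folds F H U × ¬ Folds (M (suc s)) H U
  from adm = proj₁ (adm _) ∘ folds⇒⊑blowup F H U ,
             proj₂ (adm _) ∘ folds⇒⊑blowup (M (suc s)) H U

-- Existence of a largest admissible set

admissible? : (H : Graph (Fin h)) (F : Graph (Fin f)) (s : ℕ) → Decidable (Admissible H F s)
admissible? H F s U = map (admissible⇔ H F s U)
  (¬? (folds? F H U) ×-dec ¬? (folds? (M (suc s)) H U))

largest-subset : {P : Pred (Subset h) 0ℓ} → Decidable P → P ⊥ →
  ∃ λ U → P U × (∀ U′ → P U′ → ∣ U′ ∣ ≤ ∣ U ∣)
largest-subset {h} P? p⊥ =
  -- The starting value `⊥` may itself be returned, hence the assumption that it satisfies `P`.
  argmax ∣_∣ ⊥ Us ,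
  argmax-all ∣_∣ p⊥ (All.all-filter P? (subsets h)) ,
  λ U′ p → All.lookup (f[xs]≤f[argmax] ⊥ Us) (∈-filter⁺ P? (∈-subsets U′) p)
  where Us = filter P? (subsets h)

-- Matchings and vertex covers

-- Serves to show that a matching cannot use isolated vertices of the host graph.
M-edge : ∀ k (u : Fin (k * 2)) → ∃ λ v → Adj (M k) u v
M-edge (suc k) zero          = suc zero , refl , λ ()
M-edge (suc k) (suc zero)    = zero , refl , λ ()
M-edge (suc k) (suc (suc u)) with M-edge k u
... | v , eq , u≢v = suc (suc v) , cong suc eq , u≢v ∘ suc-injective ∘ suc-injective

M-extend : ∀ {k} {G : Graph V} ((φ , _) : M k ⊑ G) {x y} → Adj G x y →
  (∀ u → φ u ≢ x) → (∀ u → φ u ≢ y) → M (suc k) ⊑ G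
M-extend {V} {k} {G} (φ , inj , hom) {x} {y} x~y ≢x ≢y = φ′ , inj′ , hom′
  where
  φ′ : Fin (suc k * 2) → V
  φ′ zero          = x
  φ′ (suc zero)    = y
  φ′ (suc (suc u)) = φ u

  inj′ : Injective _≡_ _≡_ φ′
  inj′ {zero}        {zero}        eq = refl
  inj′ {zero}        {suc zero}    eq = contradiction x~y (irrefl G eq)
  inj′ {zero}        {suc (suc v)} eq = contradiction (sym eq) (≢x v)
  inj′ {suc zero}    {zero}        eq = contradiction x~y (irrefl G (sym eq))
  inj′ {suc zero}    {suc zero}    eq = refl
  inj′ {suc zero}    {suc (suc v)} eq = contradiction (sym eq) (≢y v)
  inj′ {suc (suc u)} {zero}        eq = contradiction eq (≢x u)
  inj′ {suc (suc u)} {suc zero}    eq = contradiction eq (≢y u)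
  inj′ {suc (suc u)} {suc (suc v)} eq = cong (λ w → suc (suc w)) (inj eq)

  hom′ : ∀ u v → Adj (M (suc k)) u v → Adj G (φ′ u) (φ′ v)
  hom′ zero          zero          (_ , u≢v)  = contradiction refl u≢v
  hom′ zero          (suc zero)    _          = x~y
  hom′ zero          (suc (suc v)) (() , _)
  hom′ (suc zero)    zero          _          = symm G x~y
  hom′ (suc zero)    (suc zero)    (_ , u≢v)  = contradiction refl u≢v
  hom′ (suc zero)    (suc (suc v)) (() , _)
  hom′ (suc (suc u)) zero          (() , _)
  hom′ (suc (suc u)) (suc zero)    (() , _)
  hom′ (suc (suc u)) (suc (suc v)) (eq , u≢v) =
    hom u v (suc-injective eq , u≢v ∘ cong (λ w → suc (suc w)))

IsVertexCover : Graph V → List V → Set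
IsVertexCover G T = ∀ x y → Adj G x y → x ∈ˡ T ⊎ y ∈ˡ T

-- Greedy argument: a matching of `k` edges either extends by a disjoint edge, or every edge meets
-- one of its `k * 2` vertices, which then form a cover.
matching-or-cover : (G : Graph (Fin n)) → ∀ k →
  M k ⊑ G ⊎ ∃ λ T → length T ≤ k * 2 × IsVertexCover G T
matching-or-cover G zero    = inj₁ ((λ ()) , (λ {u} → λ {}) , λ ())
matching-or-cover G (suc k) with matching-or-cover G k
... | inj₂ (T , T≤ , cover) = inj₂ (T , ≤-trans T≤ (m≤n+m (k * 2) 2) , cover)
... | inj₁ emb@(φ , _)
  with any? (λ x → any? λ y → adj? G x y
         ×-dec (all? λ u → ¬? (φ u ≟ x)) ×-dec (all? λ u → ¬? (φ u ≟ y)))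
... | yes (x , y , x~y , ≢x , ≢y) = inj₁ (M-extend {G = G} emb x~y ≢x ≢y)
... | no saturated = inj₂ (List.tabulate φ ,
    ≤-trans (≤-reflexive (length-tabulate φ)) (m≤n+m (k * 2) 2) , cover)
  where
  missed : ∀ {x} → ¬ x ∈ˡ List.tabulate φ → ∀ u → φ u ≢ x
  missed x∉ u refl = x∉ (∈-tabulate⁺ u)

  cover : IsVertexCover G (List.tabulate φ)
  cover x y x~y with Any.any? (x ≟_) (List.tabulate φ) | Any.any? (y ≟_) (List.tabulate φ)
  ... | yes x∈ | _      = inj₁ x∈
  ... | no  _  | yes y∈ = inj₂ y∈
  ... | no  x∉ | no  y∉ = contradiction (x , y , x~y , missed x∉ , missed y∉) saturated

-- Twin classes

_≟ₛ_ : (S S′ : Subset n) → Dec (S ≡ S′)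
_≟ₛ_ = ≡-dec Bool._≟_

neighbourhood : Graph (Fin n) → Fin n → Subset n
neighbourhood G x = ⟦ adj? G x ⟧

twinClass : Graph (Fin n) → Subset n → List (Fin n)
twinClass {n} G N = filter (λ x → neighbourhood G x ≟ₛ N) (allFin n)

module _ (G : Graph (Fin n)) where

  ∈-twinClass⁻ : ∀ {N x} → x ∈ˡ twinClass G N → neighbourhood G x ≡ N
  ∈-twinClass⁻ = proj₂ ∘ ∈-filter⁻ (λ x → neighbourhood G x ≟ₛ _) {xs = allFin n}

  twinClass-unique : ∀ N → Unique (twinClass G N)
  twinClass-unique N = Unique.filter⁺ (λ x → neighbourhood G x ≟ₛ N) (Unique.allFin⁺ n)

  Twins : Fin n → Fin n → Set
  Twins x x′ = neighbourhood G x ≡ neighbourhood G x′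

  twin-adj : ∀ {x x′ y} → Twins x x′ → Adj G x y → Adj G x′ y
  twin-adj {x} {x′} eq =
    Equivalence.to (∈⟦⟧ (adj? G x′)) ∘ subst (_ ∈_) eq ∘ Equivalence.from (∈⟦⟧ (adj? G x))

  -- One end of the edge is replaced at a time. Hence a homomorphism into `G` stays one when its
  -- values are exchanged for twins.
  twins-adj : ∀ {x x′ y y′} → Twins x x′ → Twins y y′ → Adj G x y → Adj G x′ y′
  twins-adj ex ey = symm G ∘ twin-adj ey ∘ symm G ∘ twin-adj ex

  Large : ℕ → Pred (Fin n) 0ℓ
  Large K x = K ≤ length (twinClass G (neighbourhood G x))

  large? : ∀ K → Decidable (Large K)
  large? K x = K ≤? length (twinClass G (neighbourhood G x))

  large-set : ℕ → (Fin h → Fin n) → Subset h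
  large-set K φ = ⟦ large? K ∘ φ ⟧

  pick : ∀ N → .(f ≤ length (twinClass G N)) → Fin f → Fin n
  pick N f≤ v = List.lookup (twinClass G N) (inject≤ v f≤)

  pick-twin : ∀ N .(f≤ : f ≤ length (twinClass G N)) v → neighbourhood G (pick N f≤ v) ≡ N
  pick-twin N f≤ v = ∈-twinClass⁻ (∈-lookup {xs = twinClass G N} (inject≤ v f≤))

  -- Equal picks have equal neighbourhoods, so `N` and `N′` coincide, and a single twin class is
  -- enumerated without repetition.
  pick-injective : ∀ {N N′}
    .(f≤ : f ≤ length (twinClass G N)) .(f≤′ : f ≤ length (twinClass G N′)) {v v′} →
    pick N f≤ v ≡ pick N′ f≤′ v′ → v ≡ v′
  pick-injective {N = N} {N′} f≤ f≤′ {v} {v′} eq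
    with trans (sym (pick-twin N f≤ v))
               (trans (cong (neighbourhood G) eq) (pick-twin N′ f≤′ v′))
  ... | refl = inject≤-injective f≤ f≤′ v v′ (lookup-injective (twinClass-unique N) eq)

  -- Over a large vertex, `v` goes to the entry of the twin class with index `v`; over a small one,
  -- to that vertex itself. Indexing by the vertices of `F` keeps images distinct even when several
  -- vertices of `H` land in the same class.
  unfold : ∀ {F : Graph (Fin f)} {H : Graph (Fin h)} {K} → f ≤ K →
    ((φ , _) : H ⊑ G) → Folds F H (large-set K φ) → F ⊑ G
  unfold {f} {h} {F} {H} {K} f≤K (φ , φ-inj , φ-hom) (χ , χ-hom , χ-fibre) =
    θ , (λ {v} {v′} → θ-inj v v′) ,
    λ u v a → twins-adj (sym (θ-twin u)) (sym (θ-twin v)) (φ-hom _ _ (χ-hom u v a))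
    where
    select : Fin f → ∀ {x} → Dec (Large K x) → Fin n
    select v {x} (yes large) = pick (neighbourhood G x) (≤-trans f≤K large) v
    select v {x} (no  _)     = x

    select-twin : ∀ v {x} (d : Dec (Large K x)) → Twins (select v d) x
    select-twin v (yes large) = pick-twin _ (≤-trans f≤K large) v
    select-twin v (no  _)     = refl

    θ : Fin f → Fin n
    θ v = select v (large? K (φ (χ v)))

    θ-twin : ∀ v → Twins (θ v) (φ (χ v))
    θ-twin v = select-twin v (large? K (φ (χ v)))

    large-twin : ∀ {x x′} → Twins x x′ → Large K x → Large K x′
    large-twin = subst (λ N → K ≤ length (twinClass G N))

    select-inj : ∀ v v′ {x x′} (d : Dec (Large K x)) (d′ : Dec (Large K x′)) →
      Twins x x′ → select v d ≡ select v′ d′ → v ≡ v′ ⊎ (x ≡ x′ × ¬ Large K x)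
    select-inj v v′ (yes l) (yes l′) tw eq =
      inj₁ (pick-injective (≤-trans f≤K l) (≤-trans f≤K l′) eq)
    select-inj v v′ (yes l) (no ¬l′) tw eq = contradiction (large-twin tw l) ¬l′
    select-inj v v′ (no ¬l) (yes l′) tw eq = contradiction (large-twin (sym tw) l′) ¬l
    select-inj v v′ (no ¬l) (no _)   tw eq = inj₂ (eq , ¬l)

    θ-inj : ∀ v v′ → θ v ≡ θ v′ → v ≡ v′
    θ-inj v v′ eq with select-inj v v′ (large? K (φ (χ v))) (large? K (φ (χ v′)))
      (trans (sym (θ-twin v)) (trans (cong (neighbourhood G) eq) (θ-twin v′))) eq
    ... | inj₁ v≡v′ = v≡v′
    -- Both values are the small vertices themselves, so the collision already occurs in `χ`; its
    -- escape clause would make the vertex large.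
    ... | inj₂ (eq′ , small) with χ-fibre v v′ (φ-inj eq′)
    ...   | inj₁ v≡v′ = v≡v′
    ...   | inj₂ χv∈ = contradiction (Equivalence.to (∈⟦⟧ (large? K ∘ φ)) χv∈) small

-- Few vertices have a small twin class

subsetsOf : List (Fin n) → List (Subset n)
subsetsOf []      = ⊥ ∷ []
subsetsOf (t ∷ T) = cartesianProductWith (λ b S → S [ t ]≔ b) bools (subsetsOf T)

length-subsetsOf : (T : List (Fin n)) → length (subsetsOf T) ≡ 2 ^ length T
length-subsetsOf []      = refl
length-subsetsOf (t ∷ T) =
  trans (length-cartesianProductWith (λ b S → S [ t ]≔ b) bools (subsetsOf T))
        (cong (2 *_) (length-subsetsOf T))

-- Induction on `T`: clear the bit at `t`, find the resulting set in the list for the tail, then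
-- restore the bit.
∈-subsetsOf : ∀ T (S : Subset n) → (∀ {x} → x ∈ S → x ∈ˡ T) → S ∈ˡ subsetsOf T
∈-subsetsOf []      S S⊆T =
  here (⊆-antisym (λ x∈S → case S⊆T x∈S of λ ()) (λ x∈⊥ → contradiction x∈⊥ ∉⊥))
∈-subsetsOf (t ∷ T) S S⊆T = subst (_∈ˡ subsetsOf (t ∷ T)) restore
  (∈-cartesianProductWith⁺ (λ b S → S [ t ]≔ b)
    (∈-bools (lookup S t)) (∈-subsetsOf T (S [ t ]≔ false) S∖t⊆T))
  where
  restore : (S [ t ]≔ false) [ t ]≔ lookup S t ≡ S
  restore = trans ([]≔-idempotent S t) ([]≔-lookup S t)

  S∖t⊆T : ∀ {x} → x ∈ S [ t ]≔ false → x ∈ˡ T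
  S∖t⊆T {x} x∈ with x ≟ t
  ... | yes refl = case trans (sym (lookup∘updateAt x S)) ([]=⇒lookup x∈) of λ ()
  ... | no  x≢t
    with S⊆T (lookup⇒[]= x S (trans (sym (lookup∘update′ x≢t S false)) ([]=⇒lookup x∈)))
  ...   | here x≡t  = contradiction x≡t x≢t
  ...   | there x∈T = x∈T

smallVertices : Graph (Fin n) → ℕ → List (Fin n)
smallVertices {n} G K = filter (λ x → ¬? (large? G K x)) (allFin n)

-- A vertex outside the cover has its whole neighbourhood inside `T`. This leaves at most
-- `2 ^ length T` neighbourhoods, each shared by fewer than `K` small vertices.
length-smallVertices : (G : Graph (Fin n)) {T : List (Fin n)} → IsVertexCover G T → ∀ K →
  length (smallVertices G K) ≤ length T + 2 ^ length T * K
length-smallVertices {n} G {T} cover K = begin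
  length (smallVertices G K)
    ≤⟨ length-⊆ (Unique.filter⁺ small? (Unique.allFin⁺ n)) small⊆ ⟩
  length (T ++ concatMap classes (subsetsOf T))
    ≡⟨ length-++ T ⟩
  length T + length (concatMap classes (subsetsOf T))
    ≤⟨ +-monoʳ-≤ (length T) (length-concatMap-≤ classes classes≤K (subsetsOf T)) ⟩
  length T + length (subsetsOf T) * K
    ≡⟨ cong (λ l → length T + l * K) (length-subsetsOf T) ⟩
  length T + 2 ^ length T * K
    ∎
  where
  open ≤-Reasoning

  small? : Decidable (λ x → ¬ Large G K x)
  small? x = ¬? (large? G K x)

  -- Truncation bounds every class by `K` and loses nothing from the class of a small vertex.
  classes : Subset n → List (Fin n)
  classes N = take K (twinClass G N)

  classes≤K : ∀ N → length (classes N) ≤ K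
  classes≤K N = ≤-trans (≤-reflexive (length-take K (twinClass G N))) (m⊓n≤m K _)

  small⊆ : ∀ {x} → x ∈ˡ smallVertices G K → x ∈ˡ T ++ concatMap classes (subsetsOf T)
  small⊆ {x} x∈ with Any.any? (x ≟_) T
  ... | yes x∈T = ∈-++⁺ˡ x∈T
  ... | no  x∉T = ∈-++⁺ʳ T (∈-concatMap⁺ classes
    (lose (∈-subsetsOf T (neighbourhood G x) N⊆T) (subst (x ∈ˡ_) (sym all) x∈class)))
    where
    small : ¬ Large G K x
    small = proj₂ (∈-filter⁻ small? {xs = allFin n} x∈)

    all : classes (neighbourhood G x) ≡ twinClass G (neighbourhood G x)
    all = take-all K _ (≰⇒≥ small)

    x∈class : x ∈ˡ twinClass G (neighbourhood G x)
    x∈class = ∈-filter⁺ (λ y → neighbourhood G y ≟ₛ neighbourhood G x) (∈-allFin x) refl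

    N⊆T : ∀ {y} → y ∈ neighbourhood G x → y ∈ˡ T
    N⊆T {y} y∈N with cover x y (Equivalence.to (∈⟦⟧ (adj? G x)) y∈N)
    ... | inj₁ x∈T = contradiction x∈T x∉T
    ... | inj₂ y∈T = y∈T

-- Copies and embeddings

iso⇒embedding : {H : Graph (Fin h)} {G : Graph (Fin n)}
  {C : Candidate n} {φ : Fin h → Fin n} →
  IsSubgraph G C → IsIsomorphism H C φ → IsEmbedding H G φ
iso⇒embedding sub (inj , _ , iso) =
  inj , λ u v a → proj₁ (sub _ _ (Equivalence.to (iso u v) a))

-- An entry of `E` has both ends in `S`: `IsSubgraph` gives this for the first end directly, and for
-- the second by way of the symmetric entry. So every entry is the image of an edge of `H`.
copy-⊆ : {H : Graph (Fin h)} {G : Graph (Fin n)}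
  {S S′ : Subset n} {E E′ : AdjacencyMatrix n} {φ φ′ : Fin h → Fin n} →
  IsSubgraph G (S , E) → IsIsomorphism H (S , E) φ → IsIsomorphism H (S′ , E′) φ′ → φ ≗ φ′ →
  S ⊆ S′ × (∀ x → lookup E x ⊆ lookup E′ x)
copy-⊆ {S = S} {S′} {E} {E′} {φ} {φ′} sub (_ , onto , iso) (_ , onto′ , iso′) eq = S⊆ , E⊆
  where
  S⊆ : S ⊆ S′
  S⊆ {x} x∈S with Equivalence.to (onto x) x∈S
  ... | u , p = Equivalence.from (onto′ x) (u , trans (sym (eq u)) p)

  E⊆ : ∀ x → lookup E x ⊆ lookup E′ x
  E⊆ x {y} y∈E with sub x y y∈E
  ... | _ , x∈S , x∈E with sub y x x∈E
  ...   | _ , y∈S , _ with Equivalence.to (onto x) x∈S | Equivalence.to (onto y) y∈S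
  ...     | u , refl | v , refl =
    subst₂ (λ a b → b ∈ lookup E′ a) (sym (eq u)) (sym (eq v))
      (Equivalence.to (iso′ u v) (Equivalence.from (iso u v) y∈E))

-- Makes a count of embeddings an upper bound for the number of copies.
copy-unique : {H : Graph (Fin h)} {G : Graph (Fin n)}
  {C C′ : Candidate n} {φ φ′ : Fin h → Fin n} →
  IsSubgraph G C → IsSubgraph G C′ → IsIsomorphism H C φ → IsIsomorphism H C′ φ′ →
  φ ≗ φ′ → C ≡ C′
copy-unique {H = H} {G} {S , E} {S′ , E′} sub sub′ iso iso′ eq
  with copy-⊆ {H = H} {G} {S} {S′} {E} {E′} sub iso iso′ eq
     | copy-⊆ {H = H} {G} {S′} {S} {E′} {E} sub′ iso′ iso (sym ∘ eq)
... | S⊆ , E⊆ | S⊇ , E⊇ = cong₂ _,_ (⊆-antisym S⊆ S⊇)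
  (lookup-ext λ x → ⊆-antisym (E⊆ x) (E⊇ x))

module _ (H : Graph (Fin h)) (φ : Fin h → Fin n) where

  image? : ∀ x → Dec (∃ λ u → φ u ≡ x)
  image? x = any? λ u → φ u ≟ x

  imageEdge? : ∀ x y → Dec (∃₂ λ u v → φ u ≡ x × φ v ≡ y × Adj H u v)
  imageEdge? x y = any? λ u → any? λ v → (φ u ≟ x) ×-dec (φ v ≟ y) ×-dec adj? H u v

  image : Candidate n
  image = ⟦ image? ⟧ , matrix imageEdge?

  image-iso : Injective _≡_ _≡_ φ → IsIsomorphism H image φ
  image-iso inj = inj , (λ x → ∈⟦⟧ image?) , λ u v → mk⇔
    (λ a → Equivalence.from (∈-matrix imageEdge?) (u , v , refl , refl , a)) from
    where
    from : ∀ {u v} → φ v ∈ lookup (matrix imageEdge?) (φ u) → Adj H u v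
    from e with Equivalence.to (∈-matrix imageEdge?) e
    ... | _ , _ , p , q , a = subst₂ (Adj H) (inj p) (inj q) a

  image-subgraph : {G : Graph (Fin n)} → IsEmbedding H G φ → IsSubgraph G image
  image-subgraph (_ , hom) x y e with Equivalence.to (∈-matrix imageEdge?) e
  ... | u , v , refl , refl , a = hom u v a ,
    Equivalence.from (∈⟦⟧ image?) (u , refl) ,
    Equivalence.from (∈-matrix imageEdge?) (v , u , refl , refl , symm H a)

  image-copy : {G : Graph (Fin n)} → IsEmbedding H G φ → IsCopy H G image
  image-copy {G} emb@(inj , _) = image-subgraph {G} emb , φ , image-iso inj

-- The upper bound

-- Here `b` is a budget: each letter comes from `S` for free or from `L` at the price of one. In the
-- application `S` holds the small vertices and `L` all vertices.
words : (S L : List A) → ∀ h → ℕ → List (Vec A h)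
words S L zero    b       = [] ∷ []
words S L (suc h) zero    = cartesianProductWith _∷_ S (words S L h zero)
words S L (suc h) (suc b) = cartesianProductWith _∷_ S (words S L h (suc b)) ++
                            cartesianProductWith _∷_ L (words S L h b)

∈-words : {P : Pred A 0ℓ} (P? : Decidable P) {S L : List A} →
  (∀ x → ¬ P x → x ∈ˡ S) → (∀ x → x ∈ˡ L) → ∀ b (φ : Fin h → A) →
  ∣ ⟦ P? ∘ φ ⟧ ∣ ≤ b → tabulate φ ∈ˡ words S L h b
∈-words {h = zero}  P? ∈S ∈L b φ _ = here refl
∈-words {h = suc h} P? ∈S ∈L b φ ≤b with P? (φ zero)
∈-words {h = suc h} P? ∈S ∈L zero φ ≤b | no ¬p =
  ∈-cartesianProductWith⁺ _∷_ (∈S _ ¬p) (∈-words P? ∈S ∈L zero (φ ∘ suc) ≤b)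
∈-words {h = suc h} P? ∈S ∈L (suc b) φ ≤b | no ¬p =
  ∈-++⁺ˡ (∈-cartesianProductWith⁺ _∷_ (∈S _ ¬p) (∈-words P? ∈S ∈L (suc b) (φ ∘ suc) ≤b))
-- A letter satisfying `P` spends one unit; with budget zero the bound on the count excludes this
-- case.
∈-words {h = suc h} P? {S} {L} ∈S ∈L (suc b) φ (s≤s ≤b) | yes p =
  ∈-++⁺ʳ (cartesianProductWith _∷_ S (words S L h (suc b)))
    (∈-cartesianProductWith⁺ _∷_ (∈L _) (∈-words P? ∈S ∈L b (φ ∘ suc) ≤b))

-- Each position contributes a factor `suc (length S)`, the extra one paying for the letters of `L`.
-- Nonemptiness of `L` covers the unspent budget at the end of a word.
length-words : (S L : List A) → 1 ≤ length L → ∀ h b →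
  length (words S L h b) ≤ suc (length S) ^ h * length L ^ b
length-words S L L≢[] zero    b    =
  ≤-trans (m^n>0 (length L) ⦃ >-nonZero L≢[] ⦄ b) (≤-reflexive (sym (*-identityˡ _)))
length-words S L L≢[] (suc h) zero = begin
  length (words S L (suc h) 0)
    ≡⟨ length-cartesianProductWith _∷_ S (words S L h 0) ⟩
  length S * length (words S L h 0)
    ≤⟨ *-mono-≤ (n≤1+n (length S)) (length-words S L L≢[] h 0) ⟩
  suc (length S) * (suc (length S) ^ h * 1)
    ≡⟨ *-assoc (suc (length S)) (suc (length S) ^ h) 1 ⟨
  suc (length S) ^ suc h * 1
    ∎
  where open ≤-Reasoning
length-words S L L≢[] (suc h) (suc b) = begin
  length (words S L (suc h) (suc b))
    ≡⟨ length-++ (cartesianProductWith _∷_ S (words S L h (suc b))) ⟩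
  length (cartesianProductWith Vec._∷_ S (words S L h (suc b))) +
  length (cartesianProductWith Vec._∷_ L (words S L h b))
    ≡⟨ cong₂ _+_ (length-cartesianProductWith _∷_ S _) (length-cartesianProductWith _∷_ L _) ⟩
  σ * length (words S L h (suc b)) + l * length (words S L h b)
    ≤⟨ +-mono-≤ (*-monoʳ-≤ σ (length-words S L L≢[] h (suc b)))
                (*-monoʳ-≤ l (length-words S L L≢[] h b)) ⟩
  σ * (suc σ ^ h * (l * l ^ b)) + l * (suc σ ^ h * l ^ b)
    ≡⟨ expand σ l (suc σ ^ h) (l ^ b) ⟩
  suc σ ^ suc h * l ^ suc b
    ∎
  where
  open ≤-Reasoning
  σ = length S
  l = length L

  expand : ∀ σ l p q → σ * (p * (l * q)) + l * (p * q) ≡ suc σ * p * (l * q)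
  expand = solve-∀

-- Each copy is sent to the vector of values of one isomorphism onto it. This vector has at most `b`
-- large entries, and it determines the copy.
copies-≤ : (H : Graph (Fin h)) (G : Graph (Fin n)) (K b : ℕ) → 1 ≤ n →
  (∀ φ → IsEmbedding H G φ → ∣ large-set G K φ ∣ ≤ b) →
  copies H G ≤ suc (length (smallVertices G K)) ^ h * n ^ b
copies-≤ {h = h} {n = n} H G K b 1≤n few = begin
  copies H G
    ≤⟨ length-injective-relation R R-inj
         (Unique.filter⁺ (isCopy? H G) (candidates-unique n)) total ⟩
  length (words small (allFin n) h b)
    ≤⟨ length-words small (allFin n) (≤-trans 1≤n (≤-reflexive (sym n≡))) h b ⟩
  suc (length small) ^ h * length (allFin n) ^ b
    ≡⟨ cong (λ k → suc (length small) ^ h * k ^ b) n≡ ⟩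
  suc (length small) ^ h * n ^ b
    ∎
  where
  open ≤-Reasoning
  small = smallVertices G K

  n≡ : length (allFin n) ≡ n
  n≡ = length-tabulate id

  R : Candidate n → Vec (Fin n) h → Set
  R C v = IsSubgraph G C × ∃ λ φ → tabulate φ ≡ v × IsIsomorphism H C φ

  R-inj : ∀ {C C′ v} → R C v → R C′ v → C ≡ C′
  R-inj {C} {C′} (sub , φ , φ≡ , iso) (sub′ , φ′ , φ′≡ , iso′) =
    copy-unique {H = H} {G} {C} {C′} sub sub′ iso iso′ λ u →
      trans (sym (lookup∘tabulate φ u))
        (trans (cong (λ v → lookup v u) (trans φ≡ (sym φ′≡))) (lookup∘tabulate φ′ u))

  total : ∀ {C} → C ∈ˡ filter (isCopy? H G) (cartesianProduct (subsets n) (matrices n)) →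
    ∃ λ v → v ∈ˡ words small (allFin n) h b × R C v
  total {C} C∈
    with proj₂ (∈-filter⁻ (isCopy? H G) {xs = cartesianProduct (subsets n) (matrices n)} C∈)
  ... | sub , φ , iso = tabulate φ ,
    ∈-words (large? G K) (λ x → ∈-filter⁺ (λ y → ¬? (large? G K y)) (∈-allFin x)) ∈-allFin b φ
      (few φ (iso⇒embedding {H = H} {G} {C} sub iso)) ,
    sub , φ , refl , iso

-- Bounds the number of vertices in twin classes smaller than `K` when some vertex cover has size
-- `t`.
vertexBound : ℕ → ℕ → ℕ
vertexBound t K = t + 2 ^ t * K

copies-≤-free : (H : Graph (Fin h)) (F : Graph (Fin f)) (s : ℕ) {b : ℕ} →
  (∀ U → Admissible H F s U → ∣ U ∣ ≤ b) → 1 ≤ n → (G : Graph (Fin n)) →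
  ¬ F ⊑ G → ¬ M (suc s) ⊑ G →
  copies H G ≤ suc (vertexBound (suc s * 2) (f + suc s * 2)) ^ h * n ^ b
copies-≤-free {h = h} {f} {n} H F s {b} largest 1≤n G ¬F ¬M with matching-or-cover G (suc s)
... | inj₁ emb = contradiction emb ¬M
... | inj₂ (T , T≤ , cover) = begin
  copies H G
    ≤⟨ copies-≤ H G K b 1≤n few ⟩
  suc (length (smallVertices G K)) ^ h * n ^ b
    ≤⟨ *-monoˡ-≤ (n ^ b) (^-monoˡ-≤ h (s≤s small≤)) ⟩
  suc (vertexBound (suc s * 2) K) ^ h * n ^ b
    ∎
  where
  open ≤-Reasoning
  -- The sum is at least the order of `F` and at least that of the matching, so both can be
  -- unfolded.
  K = f + suc s * 2

  few : ∀ φ → IsEmbedding H G φ → ∣ large-set G K φ ∣ ≤ b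
  few φ emb = largest _ (Equivalence.to (admissible⇔ H F s (large-set G K φ))
    ( ¬F ∘ unfold G {F = F} {H} (m≤m+n f _) (φ , emb)
    , ¬M ∘ unfold G {F = M (suc s)} {H} (m≤n+m _ f) (φ , emb)))

  small≤ : length (smallVertices G K) ≤ vertexBound (suc s * 2) K
  small≤ = ≤-trans (length-smallVertices G cover K)
    (+-mono-≤ T≤ (*-monoˡ-≤ K (^-monoʳ-≤ 2 T≤)))

ex-≤ : (H : Graph (Fin h)) (𝓕 : List FiniteGraph) {v : ℕ} →
  (∀ G → Free 𝓕 G → copies H G ≤ v) → ex n H 𝓕 ≤ v
ex-≤ {n = n} H 𝓕 bound = max≤v⁺ z≤n (All.map⁺
  (All.map {P = Free 𝓕} {Q = λ G → copies H G ≤ _} (λ {G} → bound G)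
    (All.all-filter (free? 𝓕) (graphs n))))

≤-ex : (H : Graph (Fin h)) (𝓕 : List FiniteGraph) (E : AdjacencyMatrix n) →
  Free 𝓕 (fromMatrix E) → copies H (fromMatrix E) ≤ ex n H 𝓕
≤-ex {n = n} H 𝓕 E free = All.lookup
  (xs≤max 0 (List.map (copies H) (filter (free? 𝓕) (graphs n))))
  (∈-map⁺ (copies H) (∈-filter⁺ (free? 𝓕) (∈-map⁺ fromMatrix (∈-matrices E)) free))

-- The lower bound

-- Every vertex of a matching has a neighbour, and added vertices have none. So the condition
-- imposed on `F` holds automatically for matchings.
M-addIsolated : (H : Graph V) → ∀ s k → M s ⊑ addIsolated k H → M s ⊑ H
M-addIsolated {V} H s k (ψ , inj , hom) = χ , χ-inj , λ u v a →
  subst₂ (Adj (addIsolated k H)) (ψ≡ u) (ψ≡ v) (hom u v a)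
  where
  tail : ∀ x {y} → Adj (addIsolated k H) x y → ∃ λ u → x ≡ inj₁ u
  tail (inj₁ u) _ = u , refl

  base : ∀ v → ∃ λ u → ψ v ≡ inj₁ u
  base v = tail (ψ v) (hom v _ (proj₂ (M-edge s v)))

  χ = proj₁ ∘ base
  ψ≡ = proj₂ ∘ base

  χ-inj : Injective _≡_ _≡_ χ
  χ-inj {u} {v} eq = inj (trans (ψ≡ u) (trans (cong inj₁ eq) (sym (ψ≡ v))))

-- Each u has the clones e u i with i = 0 or u ∈ U; all remaining vertices are isolated.
module Spread (H : Graph (Fin h)) (U : Subset h) (e : Fin h → Fin (suc m) → Fin n)
  (e-injective : ∀ {u u′ i i′} → e u i ≡ e u′ i′ → u ≡ u′ × i ≡ i′) where

  IsClone : Fin n → Fin h → Fin (suc m) → Set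
  IsClone x u i = e u i ≡ x × (i ≡ zero ⊎ u ∈ U)

  clone? : ∀ x → Dec (∃₂ (IsClone x))
  clone? x = any? λ u → any? λ i → (e u i ≟ x) ×-dec ((i ≟ zero) ⊎-dec (u ∈? U))

  original : ∀ {x} → Dec (∃₂ (IsClone x)) → Fin h ⊎ Fin n
  original     (yes (u , _)) = inj₁ u
  original {x} (no  _)       = inj₂ x

  -- The projection of the spread onto `H` with isolated vertices added. Each vertex that is not a
  -- clone keeps an isolated image of its own.
  p : Fin n → Fin h ⊎ Fin n
  p x = original (clone? x)

  p-clone : ∀ {x u i} → IsClone x u i → p x ≡ inj₁ u
  p-clone {x} c@(eq , _) with clone? x
  ... | yes (u′ , i′ , eq′ , _) = cong inj₁ (proj₁ (e-injective (trans eq′ (sym eq))))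
  ... | no  ¬clone = contradiction (_ , _ , c) ¬clone

  -- A vertex outside `U` has only the clone with index `zero`, so distinct vertices can collide
  -- only as clones of a vertex of `U`.
  original-fibre : ∀ {x y} (d : Dec (∃₂ (IsClone x))) (d′ : Dec (∃₂ (IsClone y))) →
    original d ≡ original d′ → x ≡ y ⊎ ∃ λ u → original d ≡ inj₁ u × u ∈ U
  original-fibre (yes (u , i , eq , inj₂ u∈U)) _ _ = inj₂ (u , refl , u∈U)
  original-fibre (yes (u , _ , eq , inj₁ refl)) (yes (_ , _ , eq′ , inj₁ refl)) refl =
    inj₁ (trans (sym eq) eq′)
  original-fibre (yes (u , _ , eq , inj₁ refl)) (yes (_ , _ , eq′ , inj₂ u∈U)) refl =
    inj₂ (u , refl , u∈U)
  original-fibre (no _) (no _) eq = inj₁ (inj₂-injective eq)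

  p-fibre : ∀ {x y} → p x ≡ p y → x ≡ y ⊎ ∃ λ u → p x ≡ inj₁ u × u ∈ U
  p-fibre {x} {y} = original-fibre (clone? x) (clone? y)

  H⁺ = addIsolated n H

  adj⁺? : ∀ x y → Dec (Adj H⁺ (p x) (p y))
  adj⁺? x y = adj? H⁺ (p x) (p y)

  adjacency : AdjacencyMatrix n
  adjacency = matrix adj⁺?

  spread : Graph (Fin n)
  spread = fromMatrix adjacency

  spread-adj⁺ : ∀ {x y} → Adj H⁺ (p x) (p y) → Adj spread x y
  spread-adj⁺ a = (λ x≡y → irrefl H⁺ (cong p x≡y) a) ,
    inj₁ (Equivalence.from (∈-matrix adj⁺?) a)

  spread-adj⁻ : ∀ {x y} → Adj spread x y → Adj H⁺ (p x) (p y)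
  spread-adj⁻ (_ , inj₁ y∈) = Equivalence.to (∈-matrix adj⁺?) y∈
  spread-adj⁻ {x} {y} (_ , inj₂ x∈) =
    symm H⁺ {p y} {p x} (Equivalence.to (∈-matrix adj⁺?) x∈)

  -- Folding the isolated vertices onto `u₀` is harmless: they bear no edges, and fibres over `U`
  -- are unrestricted.
  spread-folds : (F : Graph V) {u₀ : Fin h} → u₀ ∈ U → F ⊑ spread → Folds F H U
  spread-folds F {u₀} u₀∈U (ψ , inj , hom) = χ ∘ ψ ,
    (λ u v a → base-hom (p (ψ u)) (p (ψ v)) (spread-adj⁻ (hom u v a))) ,
    λ u v eq → Sum.map₁ inj (χ-fibre eq)
    where
    base : Fin h ⊎ Fin n → Fin h
    base = [ id , (λ _ → u₀) ]′

    χ : Fin n → Fin h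
    χ = base ∘ p

    base-hom : ∀ a b → Adj H⁺ a b → Adj H (base a) (base b)
    base-hom (inj₁ u) (inj₁ v) a = a

    base-fibre : ∀ {x y} a b → p x ≡ a → p y ≡ b → base a ≡ base b → x ≡ y ⊎ base a ∈ U
    base-fibre (inj₂ _) _ _ _ _ = inj₂ u₀∈U
    base-fibre (inj₁ _) (inj₂ _) _ _ refl = inj₂ u₀∈U
    base-fibre (inj₁ u) (inj₁ .u) px py refl with p-fibre (trans px (sym py))
    ... | inj₁ x≡y = inj₁ x≡y
    ... | inj₂ (_ , px′ , u∈U) =
      inj₂ (subst (_∈ U) (inj₁-injective (trans (sym px′) px)) u∈U)

    χ-fibre : ∀ {x y} → χ x ≡ χ y → x ≡ y ⊎ χ x ∈ U
    χ-fibre = base-fibre _ _ refl refl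

  spread-free : (F : Graph V) → (∀ k → F ⊑ addIsolated k H → F ⊑ H) →
    ¬ F ⊑ H → ¬ Folds F H U → ¬ F ⊑ spread
  spread-free F addIso ¬F ¬folds emb@(ψ , inj , hom) with nonempty? U
  ... | yes (_ , u∈U) = ¬folds (spread-folds F u∈U emb)
  -- With `U` empty, `p` is injective, so `F` embeds in `H` with isolated vertices added, and
  -- `addIso` removes these.
  ... | no empty = ¬F (addIso n (p ∘ ψ , p∘ψ-inj , λ u v a → spread-adj⁻ (hom u v a)))
    where
    p∘ψ-inj : Injective _≡_ _≡_ (p ∘ ψ)
    p∘ψ-inj eq with p-fibre eq
    ... | inj₁ ψu≡ψv       = inj ψu≡ψv
    ... | inj₂ (u , _ , u∈U) = contradiction (u , u∈U) empty

  -- Copies in the spread, one for each choice of clones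

  choices : ∀ {k} → Subset k → List (Vec (Fin (suc m)) k)
  choices []          = [] ∷ []
  choices (true  ∷ V) = cartesianProductWith _∷_ (allFin (suc m)) (choices V)
  choices (false ∷ V) = cartesianProductWith _∷_ (zero ∷ []) (choices V)

  length-choices : ∀ {k} (V : Subset k) → length (choices V) ≡ suc m ^ ∣ V ∣
  length-choices []          = refl
  length-choices (true  ∷ V) = trans
    (length-cartesianProductWith _∷_ (allFin (suc m)) (choices V))
    (cong₂ _*_ (length-tabulate {n = suc m} id) (length-choices V))
  length-choices (false ∷ V) = trans
    (length-cartesianProductWith _∷_ (zero ∷ []) (choices V))
    (trans (+-identityʳ _) (length-choices V))

  choices-unique : ∀ {k} (V : Subset k) → Unique (choices V)
  choices-unique []          = [] ∷ []
  choices-unique (true  ∷ V) =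
    Unique.cartesianProductWith⁺ _∷_ ∷-injective (Unique.allFin⁺ (suc m)) (choices-unique V)
  choices-unique (false ∷ V) =
    Unique.cartesianProductWith⁺ _∷_ ∷-injective ([] ∷ []) (choices-unique V)

  ∈-choices⁻ : ∀ {k} (V : Subset k) {c} → c ∈ˡ choices V → ∀ u → lookup c u ≡ zero ⊎ u ∈ V
  ∈-choices⁻ (true ∷ V) c∈ u with ∈-cartesianProductWith⁻ _∷_ (allFin (suc m)) (choices V) c∈
  ∈-choices⁻ (true ∷ V) c∈ zero    | _ , _ , _ , _   , refl = inj₂ here
  ∈-choices⁻ (true ∷ V) c∈ (suc u) | _ , _ , _ , c∈′ , refl =
    Sum.map₂ there (∈-choices⁻ V c∈′ u)
  ∈-choices⁻ (false ∷ V) c∈ u with ∈-cartesianProductWith⁻ _∷_ (zero ∷ []) (choices V) c∈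
  ∈-choices⁻ (false ∷ V) c∈ zero    | _ , _ , here refl , _ , refl = inj₁ refl
  ∈-choices⁻ (false ∷ V) c∈ (suc u) | _ , _ , _ , c∈′ , refl =
    Sum.map₂ there (∈-choices⁻ V c∈′ u)

  place : Vec (Fin (suc m)) h → Fin h → Fin n
  place c u = e u (lookup c u)

  place-embedding : ∀ {c} → c ∈ˡ choices U → IsEmbedding H spread (place c)
  place-embedding c∈ = proj₁ ∘ e-injective , λ u v a → spread-adj⁺
    (subst₂ (Adj H⁺) (sym (p-clone (refl , ∈-choices⁻ U c∈ u)))
                     (sym (p-clone (refl , ∈-choices⁻ U c∈ v))) a)

  -- Distinct choices occupy distinct vertex sets, so the vertex set of a copy alone already
  -- recovers the choice.
  spread-copies : suc m ^ ∣ U ∣ ≤ copies H spread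
  spread-copies = subst (_≤ copies H spread) (length-choices U)
    (length-injective-relation R (λ {c} {c′} {C} → R-inj {c} {c′} {C}) (choices-unique U)
      λ {c} c∈ → image H (place c) ,
      ∈-filter⁺ (isCopy? H spread) (∈-cartesianProduct⁺ (∈-subsets _) (∈-matrices _))
            (image-copy H (place c) {spread} (place-embedding c∈)) ,
      image-iso H (place c) (proj₁ (place-embedding c∈)))
    where
    R : Vec (Fin (suc m)) h → Candidate n → Set
    R c C = IsIsomorphism H C (place c)

    R-inj : ∀ {c c′ C} → R c C → R c′ C → c ≡ c′
    R-inj {c} {c′} (_ , onto , _) (_ , onto′ , _) = lookup-ext same
      where
      same : lookup c ≗ lookup c′
      same u
        -- The clone of `u` chosen by `c` lies in the common vertex set, so `c′` chooses it too;
        -- injectivity of `e` shows that it does so for the same `u`.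
        with Equivalence.to (onto′ (place c u)) (Equivalence.from (onto (place c u)) (u , refl))
      ... | _ , eq with e-injective eq
      ...   | refl , eq′ = sym eq′

-- Asymptotics

^-distribʳ-* : ∀ k x y → (x * y) ^ k ≡ x ^ k * y ^ k
^-distribʳ-* zero    x y = refl
^-distribʳ-* (suc k) x y = trans (cong (x * y *_) (^-distribʳ-* k x y))
  ([m*n]*[o*p]≡[m*o]*[n*p] x y (x ^ k) (y ^ k))

module _ (H : Graph (Fin h)) (F : Graph (Fin f)) (s : ℕ) where

  private
    𝓕 : List FiniteGraph
    𝓕 = (_ , F) ∷ (_ , M (suc s)) ∷ []

  ex=O : ∀ {b} → (∀ U → Admissible H F s U → ∣ U ∣ ≤ b) → (λ n → ex n H 𝓕) =O (λ n → n ^ b)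
  -- The threshold 1 keeps the list of vertices nonempty, as the count of words requires.
  ex=O {b} largest = suc (vertexBound (suc s * 2) (f + suc s * 2)) ^ h , 1 , λ n 1≤n →
    ex-≤ H 𝓕 λ { G (¬F ∷ ¬M ∷ []) → copies-≤-free H F s largest 1≤n G ¬F ¬M }

  cloneCount-≤-ex : ∀ {n m} U → Admissible H F s U → ¬ F ⊑ H → ¬ M (suc s) ⊑ H →
    (∀ k → F ⊑ addIsolated k H → F ⊑ H) → h * suc m ≤ n → suc m ^ ∣ U ∣ ≤ ex n H 𝓕
  cloneCount-≤-ex {n} {m} U adm ¬F ¬M addIso h*m≤n = ≤-trans spread-copies
    (≤-ex H 𝓕 adjacency (spread-free F addIso ¬F (proj₁ ¬folds) ∷
      spread-free (M (suc s)) (M-addIsolated H (suc s)) ¬M (proj₂ ¬folds) ∷ []))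
    where
    ¬folds = Equivalence.from (admissible⇔ H F s U) adm

    e : Fin h → Fin (suc m) → Fin n
    -- The clones of `u` fill block number `u` of `h` consecutive blocks of length `suc m` at the
    -- front of `Fin n`.
    e u i = inject≤ (combine u i) h*m≤n

    open Spread H U e (λ {u} {u′} {i} {i′} eq →
      combine-injective u i u′ i′ (inject≤-injective h*m≤n h*m≤n _ _ eq))

  ^=Oex : ∀ U → Admissible H F s U → ¬ F ⊑ H → ¬ M (suc s) ⊑ H →
    (∀ k → F ⊑ addIsolated k H → F ⊑ H) → (λ n → n ^ ∣ U ∣) =O (λ n → ex n H 𝓕)
  ^=Oex U adm ¬F ¬M addIso =
    -- The number of clones is the quotient `q` of `n` by `suc h`, a divisor that is nonzero even if
    -- `H` has no vertices. The threshold makes `q` at least 1, whence `n` is at most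
    -- `2 * suc h * q`.
    (suc h * 2) ^ ∣ U ∣ , suc h , λ n h<n → bound n h<n (n / suc h) refl
    where
    open ≤-Reasoning

    regroup : ∀ h m → suc h + suc m * suc h + m * suc h ≡ suc h * 2 * suc m
    regroup = solve-∀

    bound : ∀ n → suc h ≤ n → ∀ q → n / suc h ≡ q →
            n ^ ∣ U ∣ ≤ (suc h * 2) ^ ∣ U ∣ * ex n H 𝓕
    bound n h<n zero    n/h≡ = contradiction h<n (<⇒≱ (m/n≡0⇒m<n n/h≡))
    bound n h<n (suc m) n/h≡ = begin
      n ^ ∣ U ∣                            ≤⟨ ^-monoˡ-≤ ∣ U ∣ n≤ ⟩
      (suc h * 2 * suc m) ^ ∣ U ∣          ≡⟨ ^-distribʳ-* ∣ U ∣ (suc h * 2) (suc m) ⟩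
      (suc h * 2) ^ ∣ U ∣ * suc m ^ ∣ U ∣
        ≤⟨ *-monoʳ-≤ ((suc h * 2) ^ ∣ U ∣)
             (cloneCount-≤-ex U adm ¬F ¬M addIso h*m≤n) ⟩
      (suc h * 2) ^ ∣ U ∣ * ex n H 𝓕       ∎
      where
      q≤n : suc m * suc h ≤ n
      q≤n = subst (λ q → q * suc h ≤ n) n/h≡ (m/n*n≤m n (suc h))

      h*m≤n : h * suc m ≤ n
      h*m≤n = ≤-trans (*-monoˡ-≤ (suc m) (n≤1+n h))
        (≤-trans (≤-reflexive (*-comm (suc h) (suc m))) q≤n)

      n≤ : n ≤ suc h * 2 * suc m
      n≤ = begin
        n                                ≡⟨ m≡m%n+[m/n]*n n (suc h) ⟩
        n % suc h + n / suc h * suc h    ≤⟨ +-monoˡ-≤ _ (<⇒≤ (m%n<n n (suc h))) ⟩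
        suc h + n / suc h * suc h        ≡⟨ cong (λ q → suc h + q * suc h) n/h≡ ⟩
        -- As `q` is `suc m`, adding `m * suc h` completes the remainder term `suc h` to a second
        -- `q * suc h`.
        suc h + suc m * suc h            ≤⟨ m≤m+n _ (m * suc h) ⟩
        suc h + suc m * suc h + m * suc h ≡⟨ regroup h m ⟩
        suc h * 2 * suc m                ∎

theorem6 : ∀ {h f} (H : Graph (Fin h)) (F : Graph (Fin f)) (s : ℕ) → 1 ≤ s →
    ¬ F ⊑ H → ¬ M (suc s) ⊑ H →
    (∀ k → F ⊑ addIsolated k H → F ⊑ H) →
    ∃ λ b → IsBlowupNumber H F s b ×
    (λ n → ex n H ((_ , F) ∷ (_ , M (suc s)) ∷ [])) =Θ (λ n → n ^ b)
theorem6 H F s _ ¬F ¬M addIso =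
  let ∅-admissible = Equivalence.to (admissible⇔ H F s ⊥)
        (¬F ∘ folds-⊥⇒⊑ F H , ¬M ∘ folds-⊥⇒⊑ (M (suc s)) H)
      (U , adm , largest) = largest-subset (admissible? H F s) ∅-admissible
  -- Maximality of `U` drives the upper bound, admissibility the lower bound.
  in ∣ U ∣ , ((U , adm , refl) , largest) ,
     ex=O H F s largest , ^=Oex H F s U adm ¬F ¬M addIso
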